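{- Let $r\in\mathbb N$ and let $\mathbb N=C_1\cup\dots\cup C_r$ be a finite colouring. Then there are $m\le r$ and an increasing sequence $(x_i)_{i\in\mathbb N}$ of natural numbers such that, for all $k<\ell$ in $\mathbb N$ and all indices $i_1<\dots<i_\ell$ in $\mathbb N$, the colour $C_m$ contains $$x_{i_1}+\dots+x_{i_k}\qquad\text{and}\qquad \frac{x_{i_{k+1}}+\dots+x_{i_\ell}}{x_{i_1}+\dots+x_{i_k}}.$$ (In particular, each of these quotients is a natural number.)
   Context: $\mathbb N$ denotes the set of positive integers ($0\notin\mathbb N$). A finite colouring of $\mathbb N$ is a partition of $\mathbb N$ into finitely many pieces $C_1,\dots,C_r$, called colours. -}

module Defs where

open import Data.Fin.Base as Fin using (Fin)
open import Data.List.Base using (List; tabulate; take; drop; sum)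
open import Data.Nat.Base using (ℕ; NonZero; _<_)
open import Data.Nat.Divisibility using (_∣_; quotient)
open import Data.Product.Base using (Σ-syntax)
open import Level using (0ℓ)
open import Relation.Binary.Core using (_Preserves_⟶_)
open import Relation.Binary.PropositionalEquality.Core using (_≢_)
open import Relation.Unary using (Pred; _∈_; _≐_; _⊥_; ⋃)

-- Colours are sets of positive integers; a colour may be empty.
record IsFiniteColouring {r : ℕ} (C : Fin r → Pred ℕ 0ℓ) : Set where
  field
    cover    : NonZero ≐ (⋃[ m ∶ Fin r ] C m)
    disjoint : ∀ {m n} → m ≢ n → C m ⊥ C n

Increasing : (ℕ → ℕ) → Set
Increasing x = x Preserves _<_ ⟶ _<_

IncreasingIndices : {ℓ : ℕ} → (Fin ℓ → ℕ) → Set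
IncreasingIndices i = i Preserves Fin._<_ ⟶ _<_

-- The terms x_{i₁}, …, x_{i_ℓ}, in this order.
terms : (ℕ → ℕ) → {ℓ : ℕ} → (Fin ℓ → ℕ) → List ℕ
terms x i = tabulate (λ j → x (i j))

-- x_{i₁} + … + x_{i_k}
headSum : (ℕ → ℕ) → (k : ℕ) {ℓ : ℕ} → (Fin ℓ → ℕ) → ℕ
headSum x k i = sum (take k (terms x i))

-- x_{i_{k+1}} + … + x_{i_ℓ}
tailSum : (ℕ → ℕ) → (k : ℕ) {ℓ : ℕ} → (Fin ℓ → ℕ) → ℕ
tailSum x k i = sum (drop k (terms x i))

-- For d ≠ 0, the fraction n / d is a natural number lying in A.
infix 4 _/_∈ℕ_
_/_∈ℕ_ : ℕ → ℕ → Pred ℕ 0ℓ → Set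
n / d ∈ℕ A = Σ[ d∣n ∈ d ∣ n ] quotient d∣n ∈ A

{-# OPTIONS --safe #-}

-- Dividing by one term makes a single quotient condition give both conclusions:
-- if all quotients b / a of finite sums of H, with a formed from earlier terms
-- than b, have the same colour, then so do the finite sums of H (n + 1) / H 0 and
-- their quotients. Such an H comes from the Milliken–Taylor theorem for pairs,
-- applied to a sequence in which a ∣ b for all such a and b. Hindman's theorem is
-- proved by Baumgartner's argument with large sets, and the theorem for pairs
-- follows by diagonalisation and one more application of Hindman's theorem.
module Submission where

open import Defs
open import Axiom.ExcludedMiddle using (ExcludedMiddle)
open import Data.Fin.Base as Fin using (Fin; fromℕ<; toℕ)
open import Data.Fin.Properties using (toℕ-fromℕ<)
open import Data.Nat.Base
open import Data.Nat.Divisibility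
open import Data.Nat.DivMod using (m*n/n≡m)
open import Data.Nat.Properties
open import Data.Product.Base using (_×_; _,_; proj₁; proj₂; ∃; ∃-syntax; map₂)
open import Data.Sum.Base using (_⊎_; inj₁; inj₂)
open import Function.Base using (_∘_; id)
open import Level using (0ℓ)
open import Relation.Binary.PropositionalEquality
open import Relation.Nullary using (¬_; yes; no; contradiction)
open import Relation.Unary using (Pred; _∈_; _⊆_; _∩_; U)

-- Finite sums of a sequence.

Seq : Set
Seq = ℕ → ℕ

-- The ordered index ranges make the summands distinct terms D i with p ≤ i < q.
data Sum (D : Seq) : ℕ → ℕ → ℕ → Set where
  term : ∀ {p q i} → p ≤ i → i < q → Sum D p q (D i)
  _⊕_  : ∀ {p q r s t} → Sum D p q s → Sum D q r t → Sum D p r (s + t)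

Sum⇒< : ∀ {D p q s} → Sum D p q s → p < q
Sum⇒< (term p≤i i<q) = ≤-<-trans p≤i i<q
Sum⇒< (u ⊕ v)        = <-trans (Sum⇒< u) (Sum⇒< v)

Sum-weaken : ∀ {D p p′ q q′ s} → p′ ≤ p → q ≤ q′ → Sum D p q s → Sum D p′ q′ s
Sum-weaken p′≤p q≤q′ (term p≤i i<q) = term (≤-trans p′≤p p≤i) (<-≤-trans i<q q≤q′)
Sum-weaken p′≤p q≤q′ (u ⊕ v)        = Sum-weaken p′≤p ≤-refl u ⊕ Sum-weaken ≤-refl q≤q′ v

FS : Seq → Pred ℕ 0ℓ
FS D s = ∃[ p ] ∃[ q ] Sum D p q s

step⇒mono : ∀ {f : Seq} → (∀ n → f n ≤ f (suc n)) → ∀ {m n} → m ≤ n → f m ≤ f n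
step⇒mono {f} step m≤n = go (≤⇒≤′ m≤n)
  where
  go : ∀ {m n} → m ≤′ n → f m ≤ f n
  go ≤′-refl        = ≤-refl
  go (≤′-step m≤′n) = ≤-trans (go m≤′n) (step _)

-- The summands have distinct indices between `p` and `q`, and `B` grows at each such index by at
-- least the term there. Besides `partialSum`, this serves bounds that start at 1.
Sum-bound : ∀ {D} (B : Seq) → (∀ n → B n + D n ≤ B (suc n)) →
            ∀ {p q s} → Sum D p q s → B p + s ≤ B q
Sum-bound {D} B step = go
  where
  B-mono : ∀ {m n} → m ≤ n → B m ≤ B n
  B-mono = step⇒mono (λ n → m+n≤o⇒m≤o (B n) (step n))

  go : ∀ {p q s} → Sum D p q s → B p + s ≤ B q
  go (term {i = i} p≤i i<q) =
    ≤-trans (+-monoˡ-≤ (D i) (B-mono p≤i)) (≤-trans (step i) (B-mono i<q))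
  go (_⊕_ {p} {s = s} {t} u v) =
    ≤-trans (≤-reflexive (sym (+-assoc (B p) s t))) (≤-trans (+-monoˡ-≤ t (go u)) (go v))

partialSum : Seq → Seq
partialSum D zero    = 0
partialSum D (suc n) = partialSum D n + D n

Sum≤partialSum : ∀ {D p q s} → Sum D p q s → s ≤ partialSum D q
Sum≤partialSum {D} {p} u = m+n≤o⇒n≤o (partialSum D p) (Sum-bound (partialSum D) (λ _ → ≤-refl) u)

-- Sequences of block sums.

infix 4 _⊑[_]_ _⊑_

-- A sum subsystem: a block may skip terms of `D`. The index `N` keeps room in front, so that sums
-- of `D` before `N` can be added to sums of `E`.
record _⊑[_]_ (E : Seq) (N : ℕ) (D : Seq) : Set where
  constructor refines
  field
    at    : Seq
    start : N ≤ at 0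
    block : ∀ n → Sum D (at n) (at (suc n)) (E n)

  at-mono : ∀ {m n} → m ≤ n → at m ≤ at n
  at-mono = step⇒mono (λ n → <⇒≤ (Sum⇒< (block n)))

  expand : ∀ {p q s} → Sum E p q s → Sum D (at p) (at q) s
  expand (term {i = i} p≤i i<q) = Sum-weaken (at-mono p≤i) (at-mono i<q) (block i)
  expand (u ⊕ v)                = expand u ⊕ expand v

open _⊑[_]_

_⊑_ : Seq → Seq → Set
E ⊑ D = E ⊑[ 0 ] D

⊑-refl : ∀ {D} → D ⊑ D
⊑-refl = refines id z≤n (λ n → term ≤-refl ≤-refl)

⊑-trans : ∀ {D E F M N} → F ⊑[ M ] E → (e : E ⊑[ N ] D) → F ⊑[ at e M ] D
⊑-trans f e = refines (at e ∘ at f) (at-mono e (start f)) (expand e ∘ block f)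

⊑-weaken : ∀ {D E M N} → M ≤ N → E ⊑[ N ] D → E ⊑[ M ] D
⊑-weaken M≤N e = refines (at e) (≤-trans M≤N (start e)) (block e)

⊑-trans₀ : ∀ {D E F M N} → F ⊑[ M ] E → E ⊑[ N ] D → F ⊑[ N ] D
⊑-trans₀ f e = ⊑-weaken (≤-trans (start e) (at-mono e z≤n)) (⊑-trans f e)

⊑-forget : ∀ {D E N} → E ⊑[ N ] D → E ⊑ D
⊑-forget = ⊑-weaken z≤n

FS-⊑ : ∀ {D E N} → E ⊑[ N ] D → FS E ⊆ FS D
FS-⊑ e (p , q , u) = at e p , at e q , expand e u

drop : ℕ → Seq → Seq
drop n D k = D (k + n)

drop-⊑ : ∀ n D → drop n D ⊑[ n ] D
drop-⊑ n D = refines (_+ n) ≤-refl (λ k → term ≤-refl ≤-refl)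

-- Diagonal sequences of descending chains.

record Fusion (D : ℕ → Seq) (s : Seq) : Set where
  field
    {end} : Seq
    pick  : ∀ n → Sum (D n) 0 (end n) (s n)
    next  : ∀ n → D (suc n) ⊑[ end n ] D n

  later : ∀ {m n} → m ≤ n → D n ⊑ D m
  later m≤n = go (≤⇒≤′ m≤n)
    where
    go : ∀ {m n} → m ≤′ n → D n ⊑ D m
    go ≤′-refl        = ⊑-refl
    go (≤′-step m≤′n) = ⊑-forget (⊑-trans (next _) (go m≤′n))

  fused : s ⊑ D 0
  fused = refines (λ n → at (ρ n) 0) z≤n
    (λ n → Sum-weaken ≤-refl (at-mono (ρ n) (start (next n))) (expand (ρ n) (pick n)))
    where
    ρ : ∀ n → D n ⊑ D 0
    ρ zero    = ⊑-refl
    ρ (suc n) = ⊑-forget (⊑-trans (next n) (ρ n))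

  -- Each stage starts beyond the sum picked at the stage before, so the whole sum fits in front of
  -- stage `q`.
  split : ∀ {p q t} → Sum s p q t → ∃[ N ] Sum (D p) 0 N t × D q ⊑[ N ] D p
  split (term {i = i} p≤i i<q) =
    _ , Sum-weaken z≤n ≤-refl (expand e (pick i)) ,
    ⊑-trans (⊑-trans₀ (later i<q) (next i)) e
    where e = later p≤i
  split (u ⊕ v) with split u | split v
  ... | M , u′ , e | N , v′ , f =
    _ , u′ ⊕ Sum-weaken (start e) ≤-refl (expand e v′) , ⊑-trans f e

-- Large sets.

module Classical (em : ExcludedMiddle 0ℓ) where

  Large : Pred ℕ 0ℓ → Seq → Set
  Large X D = ∀ E → E ⊑ D → ∃[ s ] FS E s × X s

  Large-⊑ : ∀ {X D E N} → E ⊑[ N ] D → Large X D → Large X E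
  Large-⊑ e large F f = large F (⊑-forget (⊑-trans f e))

  Large-⊆ : ∀ {X Y D} → X ⊆ Y → Large X D → Large Y D
  Large-⊆ X⊆Y large E e with large E e
  ... | s , s∈E , s∈X = s , s∈E , X⊆Y s∈X

  large-or-avoided : ∀ X D → Large X D ⊎ ∃[ E ] E ⊑ D × (∀ {s} → FS E s → ¬ X s)
  large-or-avoided X D with em {∃[ E ] E ⊑ D × (∀ {s} → FS E s → ¬ X s)}
  ... | yes avoided = inj₂ avoided
  ... | no ¬avoided = inj₁ large
    where
    large : Large X D
    large E e with em {∃[ s ] FS E s × X s}
    ... | yes found = found
    ... | no ¬found = contradiction (E , e , λ {s} s∈E s∈X → ¬found (s , s∈E , s∈X)) ¬avoided

  -- If the first piece is not large, some refinement avoids it; there `X` is still large and the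
  -- other pieces cover it.
  Large-⋃ : ∀ {n X D} (P : Fin n → Pred ℕ 0ℓ) → Large X D →
            (∀ {s} → FS D s → X s → ∃[ j ] P j s) →
            ∃[ j ] ∃[ E ] E ⊑ D × Large (X ∩ P j) E
  Large-⋃ {zero} P large cover with large _ ⊑-refl
  ... | s , s∈D , s∈X with cover s∈D s∈X
  ... | () , _
  Large-⋃ {suc n} {X} {D} P large cover with large-or-avoided (X ∩ P Fin.zero) D
  ... | inj₁ large₀        = Fin.zero , D , ⊑-refl , large₀
  ... | inj₂ (E , e , avoids) with Large-⋃ (P ∘ Fin.suc) (Large-⊑ e large) cover′
    where
    cover′ : ∀ {s} → FS E s → X s → ∃[ j ] P (Fin.suc j) s
    cover′ s∈E s∈X with cover (FS-⊑ e s∈E) s∈X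
    ... | Fin.zero  , s∈P = contradiction (s∈X , s∈P) (avoids s∈E)
    ... | Fin.suc j , s∈P = j , s∈P
  ... | j , F , f , large′ = Fin.suc j , F , ⊑-trans₀ f e , large′

  -- If every N failed, there would be s₀, s₁, … from successive blocks of D such
  -- that no t + sₙ with t a sum from before sₙ lies in X; then X would miss all
  -- sums of the sequence s₀ + s₁, s₂ + s₃, ….
  absorbed-front : ∀ {X D} → Large X D →
    ∃[ N ] ∀ {q s} → Sum D N q s → ∃[ t ] Sum D 0 N t × X (t + s)
  absorbed-front {X} {D} large
    with em {∃[ N ] ∀ {q s} → Sum D N q s → ∃[ t ] Sum D 0 N t × X (t + s)}
  ... | yes found = found
  ... | no ¬found = contradiction t∈X (missing t∈E)
    where
    Bad : ℕ → Set
    Bad N = ∃[ q ] ∃[ s ] Sum D N q s × (∀ {t} → Sum D 0 N t → ¬ X (t + s))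

    bad : ∀ N → Bad N
    bad N with em {Bad N}
    ... | yes b = b
    ... | no ¬b = contradiction (N , λ {q} {s} → good {q} {s}) ¬found
      where
      good : ∀ {q s} → Sum D N q s → ∃[ t ] Sum D 0 N t × X (t + s)
      good {q} {s} u with em {∃[ t ] Sum D 0 N t × X (t + s)}
      ... | yes g = g
      ... | no ¬g = contradiction (q , s , u , λ {t} v x → ¬g (t , v , x)) ¬b

    end s : Seq
    end N = proj₁ (bad N)
    s   N = proj₁ (proj₂ (bad N))

    s-sum : ∀ N → Sum D N (end N) (s N)
    s-sum N = proj₁ (proj₂ (proj₂ (bad N)))

    M : Seq
    M zero    = 0
    M (suc n) = end (end (M n))

    E : Seq
    -- Pairing is needed because sums are nonempty: it gives the last bad summand of any sum of `E`
    -- something in front of it.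
    E n = s (M n) + s (end (M n))

    e : E ⊑ D
    e = refines M z≤n (λ n → s-sum (M n) ⊕ s-sum (end (M n)))

    last : ∀ {p q t} → Sum E p q t → ∃[ u ] ∃[ N ] Sum D (M p) N u × t ≡ u + s N
    last (term {i = i} p≤i _) =
      s (M i) , end (M i) , Sum-weaken (at-mono e p≤i) ≤-refl (s-sum (M i)) , refl
    last (_⊕_ {s = t} v w) with last w
    ... | u , N , w′ , refl =
      t + u , N , expand e v ⊕ w′ , sym (+-assoc t u (s N))

    missing : ∀ {p q t} → Sum E p q t → ¬ X t
    missing v with last v
    ... | u , N , w , refl = proj₂ (proj₂ (proj₂ (bad N))) (Sum-weaken z≤n ≤-refl w)

    t∈E = proj₂ (proj₂ (proj₁ (proj₂ (large E e))))
    t∈X = proj₂ (proj₂ (large E e))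

  -- Baumgartner's argument and Hindman's theorem.

  shift : ℕ → Pred ℕ 0ℓ → Pred ℕ 0ℓ
  shift s X t = X t × X (s + t)

  record Step (Q : Pred ℕ 0ℓ) (X : Pred ℕ 0ℓ) (D : Seq) : Set where
    constructor step
    field
      {s} {end} : ℕ
      {D′}      : Seq
      pick      : Sum D 0 end s
      marked    : Q s
      next      : D′ ⊑[ end ] D
      large′    : Large (shift s X) D′

  -- Every sum beyond `N` is brought into `X` by one of the finitely many sums before `N`, so a
  -- single such sum works on a large set. That sum need not lie in `X` itself.
  weak-step : ∀ {X D} → Large X D → Step U X D
  weak-step {X} {D} large with absorbed-front large
  ... | N , absorbs with Large-⋃ P (Large-⊑ (drop-⊑ N D) large) cover
    where
    P : Fin (suc (partialSum D N)) → Pred ℕ 0ℓ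
    P j s = Sum D 0 N (toℕ j) × X (toℕ j + s)

    cover : ∀ {s} → FS (drop N D) s → X s → ∃[ j ] P j s
    cover (_ , _ , u) _ with absorbs (Sum-weaken (m≤n+m N _) ≤-refl (expand (drop-⊑ N D) u))
    ... | t , v , x = fromℕ< t<b , subst (λ t → Sum D 0 N t × X (t + _)) (sym (toℕ-fromℕ< t<b)) (v , x)
      where t<b = s≤s (Sum≤partialSum v)
  -- That `toℕ j` is a sum before `N` is part of `P j`, so any member of the large piece provides
  -- it.
  ... | j , E , e , large′ with large′ E ⊑-refl
  ... | _ , _ , _ , u , _ =
    step u _ (⊑-trans₀ e (drop-⊑ N D)) (Large-⊆ (map₂ proj₂) large′)

  module Iterate (Q : Pred ℕ 0ℓ → Pred ℕ 0ℓ)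
                 (choose : ∀ {X D} → Large X D → Step (Q X) X D)
                 {X₀ D₀} (large₀ : Large X₀ D₀) where

    record State : Set₁ where
      field
        {X}   : Pred ℕ 0ℓ
        {D}   : Seq
        large : Large X D

    open State

    advance : State → State
    advance st = record { large = Step.large′ (choose (large st)) }

    state : ℕ → State
    state zero    = record { large = large₀ }
    state (suc n) = advance (state n)

    chosen : ∀ n → Step (Q (X (state n))) (X (state n)) (D (state n))
    chosen n = choose (large (state n))

    s : Seq
    s n = Step.s (chosen n)

    fusion : Fusion (D ∘ state) s
    fusion = record { pick = Step.pick ∘ chosen ; next = Step.next ∘ chosen }

    X-antitone : ∀ {m n} → m ≤ n → X (state n) ⊆ X (state m)
    X-antitone m≤n = go (≤⇒≤′ m≤n)
      where
      go : ∀ {m n} → m ≤′ n → X (state n) ⊆ X (state m)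
      go ≤′-refl        = id
      go (≤′-step m≤′n) = go m≤′n ∘ proj₁

    -- The set after stage `i` is `shift (s i)` of the set before it, so the summands can be added
    -- one by one, the last first.
    absorb : ∀ {p q t u} → Sum s p q t → X (state q) u → X (state p) (t + u)
    absorb (term p≤i i<q) x = X-antitone p≤i (proj₂ (X-antitone i<q x))
    absorb {p} {u = w} (_⊕_ {s = t} {t′} u v) x =
      subst (X (state p)) (sym (+-assoc t t′ w)) (absorb u (absorb v x))

  -- The sequence `s` of iterated weak steps refines `D`, so some sum `t` of it lies in `X`. The
  -- large set left after the stages of `t` is contained in `shift t X`.
  strong-step : ∀ {X D} → Large X D → Step X X D
  strong-step {X} {D} large = step (proj₁ (proj₂ front)) (proj₂ (proj₂ hit)) (proj₂ (proj₂ front))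
    (Large-⊆ front-absorbed (State.large (state q)))
    where
    open Iterate (λ _ → U) weak-step large

    hit : ∃[ t ] FS s t × X t
    hit = large s (Fusion.fused fusion)

    t = proj₁ hit
    q = proj₁ (proj₂ (proj₁ (proj₂ hit)))

    u : Sum s 0 q t
    u = Sum-weaken z≤n ≤-refl (proj₂ (proj₂ (proj₁ (proj₂ hit))))

    front : ∃[ N ] Sum D 0 N t × State.D (state q) ⊑[ N ] D
    front = Fusion.split fusion u

    front-absorbed : State.X (state q) ⊆ shift t X
    front-absorbed y = X-antitone (z≤n {q}) y , absorb u y

  -- With strong steps each picked term lies in the current set, and `absorb` puts the earlier
  -- summands in front of it.
  FS⊆large : ∀ {X D} → Large X D → ∃[ E ] E ⊑ D × FS E ⊆ X
  FS⊆large {X} large = s , Fusion.fused fusion , λ (p , _ , u) → X-antitone (z≤n {p}) (sum∈ u)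
    where
    open Iterate id strong-step large

    sum∈ : ∀ {p q t} → Sum s p q t → State.X (state p) t
    sum∈ (term {i = i} p≤i _) = X-antitone p≤i (Step.marked (chosen i))
    sum∈ (u ⊕ v)              = absorb u (sum∈ v)

  -- The set of all numbers is large, hence so is some colour on a refinement.
  hindman : ∀ {r D} (P : Fin r → Pred ℕ 0ℓ) → (∀ {s} → FS D s → ∃[ m ] P m s) →
            ∃[ m ] ∃[ E ] E ⊑ D × FS E ⊆ P m
  hindman P cover =
    let m , _ , e , large = Large-⋃ {X = U} P
                              (λ E _ → E 0 , (0 , 1 , term z≤n ≤-refl) , _) (λ s∈D _ → cover s∈D)
        F , f , F⊆P       = FS⊆large large
    in m , F , ⊑-trans₀ f e , proj₂ ∘ F⊆P

  -- The Milliken-Taylor theorem for pairs.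

  module _ {r} (c : ℕ → ℕ → Fin r) where

    Homogeneous : ℕ → Seq → Fin r → Set
    Homogeneous a D m = ∀ {b} → FS D b → c a b ≡ m

    Homogeneous-suc : ∀ {B D E} → E ⊑ D →
                      (∀ {a} → a < B → ∃ (Homogeneous a D)) → ∃ (Homogeneous B E) →
                      ∀ {a} → a < suc B → ∃ (Homogeneous a E)
    Homogeneous-suc e hom homB a<1+B with m≤n⇒m<n∨m≡n (s≤s⁻¹ a<1+B)
    ... | inj₁ a<B  = map₂ (λ h b∈E → h (FS-⊑ e b∈E)) (hom a<B)
    ... | inj₂ refl = homB

    homogenise : ∀ B D → ∃[ E ] E ⊑ D × (∀ {a} → a < B → ∃ (Homogeneous a E))
    homogenise zero    D = D , ⊑-refl , λ ()
    homogenise (suc B) D =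
      let E , e , hom      = homogenise B D
          m , F , f , homB = hindman {D = E} (λ m b → c B b ≡ m) (λ {b} _ → c B b , refl)
      in F , ⊑-trans₀ f e , Homogeneous-suc f hom (m , homB)

    -- The diagonal sequence `H` makes the colour of a pair depend only on its first sum once the
    -- second is far enough out. Hindman's theorem for this eventual colour then makes it constant.
    milliken-taylor : ∀ D → ∃[ E ] E ⊑ D × ∃[ m ]
      (∀ {p q q′ a b} → Sum E p q a → Sum E q q′ b → c a b ≡ m)
    milliken-taylor D = F , ⊑-trans₀ f (⊑-trans₀ fused (proj₁ (proj₂ (homogenise 1 D)))) ,
      m , same-colour
      where
      record Stage : Set where
        field
          {bound} : ℕ
          {tail}  : Seq
          hom     : ∀ {a} → a < bound → ∃ (Homogeneous a tail)

      open Stage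

      first : Stage
      -- Starting from 1 keeps the bound at stage `q` strictly above every sum of terms of `H`
      -- before `q`.
      first = record { hom = proj₂ (proj₂ (homogenise 1 D)) }

      advance : Stage → Stage
      advance st = record
        { hom = proj₂ (proj₂ (homogenise (bound st + tail st 0) (drop 1 (tail st)))) }

      stage : ℕ → Stage
      stage zero    = first
      stage (suc n) = advance (stage n)

      H : Seq
      H n = tail (stage n) 0

      fusion : Fusion (tail ∘ stage) H
      fusion = record
        { pick = λ n → term z≤n ≤-refl
        ; next = λ n → ⊑-trans₀ (proj₁ (proj₂ (homogenise (bound (stage n) + H n) (drop 1 (tail (stage n))))))
                                (drop-⊑ 1 (tail (stage n)))
        }

      open Fusion fusion

      tail-homogeneous : ∀ {p q a} → Sum H p q a → ∃ (Homogeneous a (tail (stage q)))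
      tail-homogeneous {p} {q} {a} u = hom (stage q) (begin-strict
        a                        <⟨ n<1+n a ⟩
        1 + a                    ≤⟨ +-monoˡ-≤ a (step⇒mono {bound ∘ stage} (λ n → m≤m+n _ (H n)) (z≤n {p})) ⟩
        bound (stage p) + a      ≤⟨ Sum-bound (bound ∘ stage) (λ _ → ≤-refl) u ⟩
        bound (stage q)          ∎)
        where open ≤-Reasoning

      -- Both tails have the term `H (p + q)` among their sums, and its pair with `a` has one
      -- colour.
      homogeneous-unique : ∀ {a m n} p q → Homogeneous a (tail (stage p)) m →
                           Homogeneous a (tail (stage q)) n → m ≡ n
      homogeneous-unique p q h h′ =
        trans (sym (h (FS-⊑ (later (m≤m+n p q)) b∈))) (h′ (FS-⊑ (later (m≤n+m q p)) b∈))
        where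
        b∈ : FS (tail (stage (p + q))) (H (p + q))
        b∈ = 0 , 1 , term z≤n ≤-refl

      EventualColour : Fin r → Pred ℕ 0ℓ
      EventualColour m a = ∃[ n ] Homogeneous a (tail (stage n)) m

      eventual : ∃[ m ] ∃[ E ] E ⊑ H × FS E ⊆ EventualColour m
      eventual = hindman EventualColour
        (λ (_ , q , u) → proj₁ (tail-homogeneous u) , q , proj₂ (tail-homogeneous u))

      m = proj₁ eventual
      F = proj₁ (proj₂ eventual)
      f = proj₁ (proj₂ (proj₂ eventual))

      same-colour : ∀ {p q q′ a b} → Sum F p q a → Sum F q q′ b → c a b ≡ m
      same-colour {p} {q} u v =
        -- The tail at stage `at f q` is already homogeneous for `a`, and by `split` it has `b`
        -- among its sums.
        let _ , h     = tail-homogeneous (expand f u)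
            N , w , _ = split (expand f v)
            n , h′    = proj₂ (proj₂ (proj₂ eventual)) (p , q , u)
        in trans (h (0 , N , w)) (homogeneous-unique (at f q) n h h′)

-- A sequence whose earlier sums divide the later ones.

Sparse : Seq → Set
Sparse D = ∀ {p q r a b} → Sum D p q a → Sum D q r b → NonZero a × a ∣ b × a < b

Sparse-⊑ : ∀ {D E} → E ⊑ D → Sparse D → Sparse E
Sparse-⊑ e sparse u v = sparse (expand e u) (expand e v)

-- One more than the sum of all earlier terms of `sparse-seq`.
sparse-bound : Seq
sparse-bound zero    = 1
sparse-bound (suc n) = sparse-bound n + sparse-bound n !

sparse-seq : Seq
sparse-seq n = sparse-bound n !

-- Terms from `q` on are factorials of numbers at least `sparse-bound q`, which exceeds `a`. So `a`
-- divides `b`, and so does `sparse-bound q`, which gives `a < b`.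
sparse-seq-sparse : Sparse sparse-seq
sparse-seq-sparse {p} {q} {a = a} {b} u v =
  a≢0 , divides-later a≢0 (<⇒≤ a<B) v ,
  <-≤-trans a<B (∣⇒≤ {{sum≢0 v}} (divides-later B≢0 ≤-refl v))
  where
  B-mono : ∀ {m n} → m ≤ n → sparse-bound m ≤ sparse-bound n
  B-mono = step⇒mono (λ n → m≤m+n _ (sparse-seq n))

  a<B : a < sparse-bound q
  a<B = ≤-trans (+-monoˡ-≤ a (B-mono (z≤n {p}))) (Sum-bound sparse-bound (λ _ → ≤-refl) u)

  sum≢0 : ∀ {p q s} → Sum sparse-seq p q s → NonZero s
  sum≢0 (term {i = i} _ _) = sparse-bound i !≢0
  sum≢0 (_⊕_ {s = s} {t} u v) = >-nonZero (<-≤-trans (>-nonZero⁻¹ s {{sum≢0 u}}) (m≤m+n s t))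

  a≢0 : NonZero a
  a≢0 = sum≢0 u

  B≢0 : NonZero (sparse-bound q)
  B≢0 = >-nonZero (B-mono (z≤n {q}))

  divides-later : ∀ {d p r s} → NonZero d → d ≤ sparse-bound p → Sum sparse-seq p r s → d ∣ s
  divides-later d≢0 d≤B (term p≤i _) = ∣-trans (n∣n! d≢0) (m≤n⇒m!∣n! (≤-trans d≤B (B-mono p≤i)))
    where
    n∣n! : ∀ {n} → NonZero n → n ∣ n !
    n∣n! {suc n} _ = m∣m*n (n !)
  divides-later d≢0 d≤B (u ⊕ v) =
    ∣m∣n⇒∣m+n (divides-later d≢0 d≤B u) (divides-later d≢0 (≤-trans d≤B (B-mono (<⇒≤ (Sum⇒< u)))) v)

-- Scaling, and sums over increasing indices.

Sum-* : ∀ {D E} d k → (∀ n → D (n + k) ≡ E n * d) →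
        ∀ {p q s} → Sum E p q s → Sum D (p + k) (q + k) (s * d)
Sum-* d k D≡E*d (term {i = i} p≤i i<q) =
  subst (Sum _ _ _) (D≡E*d i) (term (+-monoˡ-≤ k p≤i) (+-monoˡ-< k i<q))
Sum-* d k D≡E*d (_⊕_ {s = s} {t} u v) =
  subst (Sum _ _ _) (sym (*-distribʳ-+ d s t)) (Sum-* d k D≡E*d u ⊕ Sum-* d k D≡E*d v)

tailSum-Sum : ∀ x {p n} (i : Fin (suc n) → ℕ) → IncreasingIndices i → p ≤ i Fin.zero →
              ∃[ q ] Sum x p q (tailSum x 0 i)
tailSum-Sum x {n = zero} i inc p≤i =
  _ , subst (Sum x _ _) (sym (+-identityʳ _)) (term p≤i ≤-refl)
tailSum-Sum x {n = suc n} i inc p≤i =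
  map₂ (term p≤i ≤-refl ⊕_) (tailSum-Sum x (i ∘ Fin.suc) (inc ∘ s<s) (inc z<s))

-- The cut `q` is one past the last index of the head. The condition `k < n` leaves the tail
-- nonempty, as `Sum` requires.
headSum-tailSum-Sum :
  ∀ x {p} k {n} (i : Fin (suc n) → ℕ) → k < n → IncreasingIndices i → p ≤ i Fin.zero →
  ∃[ q ] ∃[ r ] Sum x p q (headSum x (suc k) i) × Sum x q r (tailSum x (suc k) i)
headSum-tailSum-Sum x zero {suc n} i _ inc p≤i
  with tailSum-Sum x (i ∘ Fin.suc) (inc ∘ s<s) (inc z<s)
... | r , v = _ , r , subst (Sum x _ _) (sym (+-identityʳ _)) (term p≤i ≤-refl) , v
headSum-tailSum-Sum x (suc k) {suc n} i (s≤s k<n) inc p≤i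
  with headSum-tailSum-Sum x k (i ∘ Fin.suc) k<n (inc ∘ s<s) (inc z<s)
... | q , r , u , v = q , r , term p≤i ≤-refl ⊕ u , v

-- The value 0 for a = 0 is junk.
ratio : ℕ → ℕ → ℕ
ratio zero    b = 0
ratio (suc a) b = b / suc a

ratio-* : ∀ k {a} → NonZero a → ratio a (k * a) ≡ k
ratio-* k {suc a} _ = m*n/n≡m k (suc a)

step⇒strictlyMono : ∀ {f : Seq} → (∀ n → f n < f (suc n)) → Increasing f
step⇒strictlyMono step m<n = <-≤-trans (step _) (step⇒mono (<⇒≤ ∘ step) m<n)

-- A sum `a` of `x` is the quotient of `a * H 0` by `H 0`, and the factor `H 0` cancels from the
-- quotient of two sums. Starting `x` at index 1 of `H` keeps `H 0` in front of all sums used.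
scaled-sequence : ∀ {A H} → Sparse H →
  (∀ {p q q′ a k} → Sum H p q a → Sum H q q′ (k * a) → k ∈ A) →
  ∃[ x ] ∀ {p q q′ a b} → Sum x p q a → Sum x q q′ b →
    NonZero a × a < b × a ∈ A × (b / a ∈ℕ A)
scaled-sequence {A} {H} sparse quotient-∈ = x , x-sums
  where
  H₀ : Sum H 0 1 (H 0)
  H₀ = term ≤-refl ≤-refl

  H₀∣H : ∀ n → H 0 ∣ H (n + 1)
  H₀∣H n = proj₁ (proj₂ (sparse H₀ (term {q = suc (n + 1)} (m≤n+m 1 n) ≤-refl)))

  x : Seq
  x n = quotient (H₀∣H n)

  unscale : ∀ {p q s} → Sum x p q s → Sum H (p + 1) (q + 1) (s * H 0)
  unscale = Sum-* (H 0) 1 (λ n → m∣n⇒n≡quotient*m (H₀∣H n))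

  x-sums : ∀ {p q q′ a b} → Sum x p q a → Sum x q q′ b →
           NonZero a × a < b × a ∈ A × (b / a ∈ℕ A)
  x-sums {p} {a = a} {b} u v with sparse (unscale u) (unscale v)
  ... | aH₀≢0 , aH₀∣bH₀ , aH₀<bH₀ =
    m*n≢0⇒m≢0 a {{aH₀≢0}} , *-cancelʳ-< (H 0) a b aH₀<bH₀ ,
    quotient-∈ H₀ (Sum-weaken (m≤n+m 1 p) ≤-refl (unscale u)) ,
    a∣b , quotient-∈ (unscale u) (subst (Sum H _ _) bH₀≡k*aH₀ (unscale v))
    where
    a∣b : a ∣ b
    a∣b = *-cancelʳ-∣ (H 0) {{m*n≢0⇒n≢0 a {{aH₀≢0}}}} aH₀∣bH₀

    bH₀≡k*aH₀ : b * H 0 ≡ quotient a∣b * (a * H 0)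
    bH₀≡k*aH₀ = trans (cong (_* H 0) (m∣n⇒n≡quotient*m a∣b)) (*-assoc (quotient a∣b) a (H 0))

-- Colouring pairs by the colour of their quotient.

theoremA : ExcludedMiddle 0ℓ →
    (r : ℕ) → .{{_ : NonZero r}} →
    (C : Fin r → Pred ℕ 0ℓ) → IsFiniteColouring C →
    ∃[ m ] ∃[ x ] (∀ n → NonZero (x n)) × Increasing x ×
    (∀ (k ℓ : ℕ) → .{{_ : NonZero k}} → k < ℓ →
    (i : Fin ℓ → ℕ) → IncreasingIndices i →
    (headSum x k i ∈ C m) × (tailSum x k i / headSum x k i ∈ℕ C m))
theoremA em (suc r) C isColouring =
  conclude (Classical.milliken-taylor em (λ a b → colour (ratio a b)) sparse-seq)
  where
  colour : ℕ → Fin (suc r)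
  -- A default value: 0 lies in no colour class.
  colour zero    = Fin.zero
  colour (suc n) = proj₁ (proj₁ (IsFiniteColouring.cover isColouring) {suc n} _)

  colour-∈ : ∀ {n m} → NonZero n → colour n ≡ m → n ∈ C m
  colour-∈ {suc n} _ refl = proj₂ (proj₁ (IsFiniteColouring.cover isColouring) {suc n} _)

  quotient-∈ : ∀ {H m} → Sparse H →
    (∀ {p q q′ a b} → Sum H p q a → Sum H q q′ b → colour (ratio a b) ≡ m) →
    ∀ {p q q′ a k} → Sum H p q a → Sum H q q′ (k * a) → k ∈ C m
  quotient-∈ sparse same {k = k} u v with sparse u v
  -- The quotient `k` is nonzero because `k * a` exceeds `a`.
  ... | a≢0 , _ , a<ka = colour-∈ (m*n≢0⇒m≢0 k {{>-nonZero (≤-<-trans z≤n a<ka)}})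
    (trans (cong colour (sym (ratio-* k a≢0))) (same u v))

  conclude : ∃[ H ] H ⊑ sparse-seq × ∃[ m ]
      (∀ {p q q′ a b} → Sum H p q a → Sum H q q′ b → colour (ratio a b) ≡ m) →
    ∃[ m ] ∃[ x ] (∀ n → NonZero (x n)) × Increasing x ×
    (∀ (k ℓ : ℕ) → .{{_ : NonZero k}} → k < ℓ →
    (i : Fin ℓ → ℕ) → IncreasingIndices i →
    (headSum x k i ∈ C m) × (tailSum x k i / headSum x k i ∈ℕ C m))
  conclude (H , H⊑ , m , same) =
    m , x , proj₁ ∘ consecutive , step⇒strictlyMono (λ n → proj₁ (proj₂ (consecutive n))) ,
    head-tail
    where
    H-sparse = Sparse-⊑ H⊑ sparse-seq-sparse
    scaled   = scaled-sequence H-sparse (quotient-∈ H-sparse same)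
    x        = proj₁ scaled

    consecutive : ∀ n → NonZero (x n) × x n < x (suc n) × x n ∈ C m × (x (suc n) / x n ∈ℕ C m)
    consecutive n = proj₂ scaled (term {i = n} ≤-refl ≤-refl) (term {i = suc n} ≤-refl ≤-refl)

    head-tail : ∀ (k ℓ : ℕ) → .{{_ : NonZero k}} → k < ℓ →
      (i : Fin ℓ → ℕ) → IncreasingIndices i →
      (headSum x k i ∈ C m) × (tailSum x k i / headSum x k i ∈ℕ C m)
    head-tail (suc k) (suc ℓ) (s≤s k<ℓ) i inc =
      let _ , _ , u , v = headSum-tailSum-Sum x k i k<ℓ inc z≤n
      in proj₂ (proj₂ (proj₂ scaled u v))
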